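{- Let $k\geq 2$ be an integer and let $D,\lambda>0$ be constants with $D\geq 64k^2$ and $\lambda\geq1$. Let $n_0=(8\lambda)^k$. There exists a constant $\beta=\beta(D,\lambda,k)>0$ such that every $n$-vertex graph $G$ with $n\geq n_0$ in which every vertex $v$ satisfies $Dn^{1/k}\leq d(v)\leq\lambda Dn^{1/k}$ satisfies $t_{C_{2k}}(G)\geq\beta n^2$.
   Context: Graphs are $2$-uniform; $d(v)$ is the degree of $v$; $C_{2k}$ is the cycle of length $2k$; $t_{C_{2k}}(G)$ is the number of subgraphs of $G$ isomorphic to $C_{2k}$.
   Formalization: The constants D and λ are taken to be rational numbers instead of real numbers. -}

module Defs where

open import Data.Nat as ℕ using (ℕ; zero; suc; _≤_)
open import Data.Nat.DivMod using (_/_)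
open import Data.Bool using (Bool; true; false; _∧_; not; if_then_else_)
open import Data.Fin using (Fin)
import Data.Fin as Fin
open import Data.List using (List; []; _∷_; [_]; _++_; map; concatMap)
open import Data.Nat.ListAction using (sum)
open import Data.Bool.ListAction using (any)
open import Data.Fin.Base using ()
open import Data.List using (allFin)
open import Data.Integer using (+_)
open import Data.Rational using (ℚ; 1ℚ; _*_) renaming (_/_ to _÷ℚ_)
open import Relation.Nullary.Decidable using (⌊_⌋)
open import Relation.Binary.PropositionalEquality using (_≡_)

record Graph (n : ℕ) : Set where
  field
    adj    : Fin n → Fin n → Bool
    sym    : ∀ i j → adj i j ≡ adj j i
    irrefl : ∀ i → adj i i ≡ false
open Graph public

count : {A : Set} → (A → Bool) → List A → ℕ
count p xs = sum (map (λ x → if p x then 1 else 0) xs)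

degree : {n : ℕ} → Graph n → Fin n → ℕ
degree {n} G v = count (adj G v) (allFin n)

allSeqs : ℕ → (n : ℕ) → List (List (Fin n))
allSeqs zero    n = [ [] ]
allSeqs (suc m) n = concatMap (λ xs → map (λ x → x ∷ xs) (allFin n)) (allSeqs m n)

allDistinct : {n : ℕ} → List (Fin n) → Bool
allDistinct []       = true
allDistinct (x ∷ xs) = not (any (λ y → ⌊ x Fin.≟ y ⌋) xs) ∧ allDistinct xs

consecAdj : {n : ℕ} → Graph n → List (Fin n) → Bool
consecAdj G (x ∷ y ∷ r) = adj G x y ∧ consecAdj G (y ∷ r)
consecAdj G _           = true

closedWalk : {n : ℕ} → Graph n → List (Fin n) → Bool
closedWalk G []       = true
closedWalk G (x ∷ xs) = consecAdj G ((x ∷ xs) ++ [ x ])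

labelledCycles : {n : ℕ} → ℕ → Graph n → ℕ
labelledCycles {n} k G =
  count (λ xs → allDistinct xs ∧ closedWalk G xs) (allSeqs (2 ℕ.* k) n)

-- t_{C_{2k}}(G): number of subgraphs isomorphic to C_{2k}.  For k ≥ 2 each
-- such subgraph corresponds to exactly 2·2k = 4k labelled cycles
-- (rotations and reflections), so this division is exact.
tC2k : {n : ℕ} → ℕ → Graph n → ℕ
tC2k zero    G = 0
tC2k (suc j) G = labelledCycles (suc j) G / (4 ℕ.* suc j)

toℚ : ℕ → ℚ
toℚ m = (+ m) ÷ℚ 1

_^ℚ_ : ℚ → ℕ → ℚ
q ^ℚ zero  = 1ℚ
q ^ℚ suc m = q * (q ^ℚ m)
infixr 8 _^ℚ_

{-# OPTIONS --safe #-}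
module Submission where

-- Weight a closed walk by the product of 1 / d(x) over its vertices.  Let P be the transition
-- matrix of the simple random walk, m_j(x) = (P^j)(x, x) and T = tr P^2k, the total weight of the
-- closed walks of length 2k; T ≥ 1.  Since P is reversible, j ↦ m_j(x) satisfies the moment
-- inequalities m_{a+b}² ≤ m_{2a} m_{2b}.  The closed walks with x₀ = x_j have total weight
-- Σ_x m_j(x) m_{2k-j}(x) ≤ Σ_x m_2(x) m_{2k-2}(x) ≤ (1/δ) tr P^(2k-2), δ being the minimum
-- degree, and log-convexity of the even traces gives (tr P^(2k-2))^k ≤ n T^(k-1).  With
-- δ^k ≥ D^k n this is at most T / D, so D ≥ 64 k² leaves at least half of T to genuine cycles.
-- Each cycle weighs at most δ^(-2k) ≤ D^(-2k) n^(-2), hence there are many of them; one can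
-- take β = 1.
--
-- To stay in ℕ, the weights 1 / d(x) are scaled by the product L of all degrees.

open import Defs hiding (sym)
open import Data.Nat using (ℕ; zero; suc; _+_; _∸_; _^_; _≤_; _<_; z≤n; s≤s; NonZero; ≢-nonZero; ≢-nonZero⁻¹; >-nonZero; >-nonZero⁻¹)
open import Data.Nat.Properties
open import Data.Nat.Tactic.RingSolver using (solve-∀)
open import Data.Bool using (Bool; true; false; _∧_; if_then_else_)
open import Data.Bool.ListAction using (any)
open import Data.Fin using (Fin; zero; suc)
import Data.Fin as Fin
open import Data.List using (List; []; _∷_; [_]; _++_; map; concatMap; length; allFin; tabulate; upTo)
open import Data.List.Properties using (map-tabulate; map-upTo; map-++; map-∘; length-tabulate; length-upTo)
open import Data.Nat.ListAction using (sum; product)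
open import Data.Nat.ListAction.Properties using (sum-++; ∈⇒∣product; product≢0)
open import Data.Nat.DivMod using (_/_; m*n/n≡m; m/n*n≡m; /-monoˡ-≤)
import Data.Nat.Coprimality as Coprimality
open import Data.List.Membership.Propositional.Properties using (∈-map⁺; ∈-allFin)
open import Data.List.Relation.Unary.All using (universal)
open import Data.List.Relation.Unary.All.Properties using () renaming (map⁺ to All-map⁺)
open import Data.Product using (Σ; _×_; _,_; proj₁; proj₂; ∃)
open import Data.Sum using (inj₁; inj₂)
open import Relation.Nullary using (yes; no; contradiction)
open import Relation.Nullary.Decidable using (⌊_⌋)
open import Relation.Binary.PropositionalEquality hiding ([_])
open import Function using (id; _∘_)

-- Elementary arithmetic: roots, the mean inequality and parity.

module Arithmetic where

  open Data.Nat using (_*_)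

  m²≤n²⇒m≤n : ∀ m n → m * m ≤ n * n → m ≤ n
  m²≤n²⇒m≤n m n m²≤n² = ≮⇒≥ λ n<m → <⇒≱ (*-mono-< n<m n<m) m²≤n²

  m^k≤n^k⇒m≤n : ∀ k m n → m ^ suc k ≤ n ^ suc k → m ≤ n
  m^k≤n^k⇒m≤n k m n le = ≮⇒≥ λ n<m → <⇒≱ (^-monoˡ-< (suc k) n<m) le

  -- Writing the larger number as the smaller plus `o`, the two sides differ by `o * o`.
  4mn≤[m+n]² : ∀ m n → 4 * (m * n) ≤ (m + n) * (m + n)
  4mn≤[m+n]² m n with ≤-total m n
  ... | inj₁ m≤n with m≤n⇒∃[o]m+o≡n m≤n
  ...   | o , refl = m+n≤o⇒m≤o _ (≤-reflexive (identity m o))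
    where
    identity : ∀ m o → 4 * (m * (m + o)) + o * o ≡ (m + (m + o)) * (m + (m + o))
    identity = solve-∀
  4mn≤[m+n]² m n | inj₂ n≤m with m≤n⇒∃[o]m+o≡n n≤m
  ...   | o , refl = m+n≤o⇒m≤o _ (≤-reflexive (identity n o))
    where
    identity : ∀ n o → 4 * ((n + o) * n) + o * o ≡ ((n + o) + n) * ((n + o) + n)
    identity = solve-∀

  -- The inequality of arithmetic and geometric means without square roots; it handles the cross
  -- term in `∑-Cauchy-Schwarz`.
  o²≤mn⇒2o≤m+n : ∀ {m n o} → o * o ≤ m * n → 2 * o ≤ m + n
  o²≤mn⇒2o≤m+n {m} {n} {o} o²≤mn = m²≤n²⇒m≤n _ _ (begin
    (2 * o) * (2 * o)  ≡⟨ identity o ⟩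
    4 * (o * o)        ≤⟨ *-monoʳ-≤ 4 o²≤mn ⟩
    4 * (m * n)        ≤⟨ 4mn≤[m+n]² m n ⟩
    (m + n) * (m + n)  ∎)
    where
    open ≤-Reasoning
    identity : ∀ o → (2 * o) * (2 * o) ≡ 4 * (o * o)
    identity = solve-∀

  ^-distribʳ-* : ∀ k m n → (m * n) ^ k ≡ m ^ k * n ^ k
  ^-distribʳ-* zero    m n = refl
  ^-distribʳ-* (suc k) m n = trans (cong (m * n *_) (^-distribʳ-* k m n)) (identity m n (m ^ k) (n ^ k))
    where
    identity : ∀ a b c d → a * b * (c * d) ≡ a * c * (b * d)
    identity = solve-∀

  -- Doubles appear as `p + p`, the shape that even indices have in `MomentLike`.
  data Parity : ℕ → Set where
    even : ∀ p → Parity (p + p)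
    odd  : ∀ p → Parity (suc (p + p))

  parity : ∀ n → Parity n
  parity zero = even 0
  parity (suc n) with parity n
  ... | even p = odd p
  ... | odd  p = subst Parity (cong suc (+-suc p p)) (even (suc p))

  m+m≢1+n+n : ∀ m n → m + m ≢ suc (n + n)
  m+m≢1+n+n (suc m) zero    eq = m+1+n≢0 m (suc-injective eq)
  m+m≢1+n+n (suc m) (suc n) eq = m+m≢1+n+n m n
    (suc-injective (trans (sym (+-suc m m)) (trans (suc-injective eq) (cong suc (+-suc n n)))))

  m+m-injective : ∀ m n → m + m ≡ n + n → m ≡ n
  m+m-injective m n eq = *-cancelˡ-≡ m n 2 (trans (double m) (trans eq (sym (double n))))
    where
    double : ∀ m → 2 * m ≡ m + m
    double = solve-∀

open Arithmetic

-- Log-convex sequences and moment inequalities.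

module LogConvexity where

  open Data.Nat using (_*_)

  LogConvex : (ℕ → ℕ) → Set
  LogConvex s = ∀ i → s (suc i) * s (suc i) ≤ s i * s (suc (suc i))

  -- The hypotheses read x/u ≤ z/y and z/y ≤ w/z, and the conclusion is x/u ≤ w/z. Cross-multiplied,
  -- only the case `z = 0` has to be treated apart.
  cancel-middle : ∀ {u w x y z} → x * y ≤ u * z → z * z ≤ y * w → x * z ≤ u * w
  cancel-middle {u} {w} {x} {y} {zero}    _     _     = ≤-trans (≤-reflexive (*-zeroʳ x)) z≤n
  cancel-middle {u} {w} {x} {y} {z@(suc _)} xy≤uz zz≤yw = *-cancelʳ-≤ _ _ z (begin
    x * z * z    ≡⟨ *-assoc x z z ⟩
    x * (z * z)  ≤⟨ *-monoʳ-≤ x zz≤yw ⟩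
    x * (y * w)  ≡⟨ *-assoc x y w ⟨
    x * y * w    ≤⟨ *-monoˡ-≤ w xy≤uz ⟩
    u * z * w    ≡⟨ *-assoc u z w ⟩
    u * (z * w)  ≡⟨ cong (u *_) (*-comm z w) ⟩
    u * (w * z)  ≡⟨ *-assoc u w z ⟨
    u * w * z    ∎)
    where open ≤-Reasoning

  module _ {s : ℕ → ℕ} (lc : LogConvex s) where

    -- Log-convexity makes the ratios s(i+1)/s(i) nondecreasing; this compares the one at `a` with
    -- the one at `e + a`, cross-multiplied because terms may vanish.
    ratio-mono : ∀ a e → s (suc a) * s (e + a) ≤ s a * s (suc (e + a))
    ratio-mono a zero    = ≤-reflexive (*-comm (s (suc a)) (s a))
    ratio-mono a (suc e) =
      cancel-middle {u = s a} {x = s (suc a)} (ratio-mono a e) (lc (e + a))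

    -- Moving the smaller index down by one and the larger up by one never decreases the product;
    -- this is repeated until the smaller index is 0.
    spread-≤ : ∀ a b → a ≤ b → s a * s b ≤ s 0 * s (a + b)
    spread-≤ zero    b _   = ≤-refl
    spread-≤ (suc a) b a<b = begin
      s (suc a) * s b         ≡⟨ cong (λ i → s (suc a) * s i) b≡ ⟨
      s (suc a) * s (e + a)   ≤⟨ ratio-mono a e ⟩
      s a * s (suc (e + a))   ≡⟨ cong (λ i → s a * s (suc i)) b≡ ⟩
      s a * s (suc b)         ≤⟨ spread-≤ a (suc b) (m≤n⇒m≤1+n (<⇒≤ a<b)) ⟩
      s 0 * s (a + suc b)     ≡⟨ cong (λ i → s 0 * s i) (+-suc a b) ⟩
      s 0 * s (suc (a + b))   ∎
      where
      open ≤-Reasoning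
      e = b ∸ a
      b≡ : e + a ≡ b
      b≡ = m∸n+n≡m (<⇒≤ a<b)

    spread : ∀ a b → s a * s b ≤ s 0 * s (a + b)
    spread a b with ≤-total a b
    ... | inj₁ a≤b = spread-≤ a b a≤b
    ... | inj₂ b≤a = begin
      s a * s b        ≡⟨ *-comm (s a) (s b) ⟩
      s b * s a        ≤⟨ spread-≤ b a b≤a ⟩
      s 0 * s (b + a)  ≡⟨ cong (λ i → s 0 * s i) (+-comm b a) ⟩
      s 0 * s (a + b)  ∎
      where open ≤-Reasoning

    -- Log-convex interpolation of the term `i` between the terms 0 and `suc i`. For the induction,
    -- log-convexity is raised to the power `suc i`, the previous bound is inserted and `y ^ i` is
    -- cancelled; if `y = 0`, the left side vanishes.
    power-bound : ∀ i → s i ^ suc i ≤ s 0 * s (suc i) ^ i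
    power-bound zero    = ≤-refl
    power-bound (suc i) with s (suc i) ≟ 0
    ... | yes s≡0 = ≤-trans (≤-reflexive (cong (_^ suc (suc i)) s≡0)) z≤n
    ... | no  s≢0 = *-cancelʳ-≤ _ _ (y ^ i) {{m^n≢0 y i {{≢-nonZero s≢0}}}} (begin
      y * (y * y ^ i) * y ^ i        ≡⟨ identity₁ y (y ^ i) ⟩
      (y * y ^ i) * (y * y ^ i)      ≡⟨ ^-distribʳ-* (suc i) y y ⟨
      (y * y) ^ suc i                ≤⟨ ^-monoˡ-≤ (suc i) (lc i) ⟩
      (x * z) ^ suc i                ≡⟨ ^-distribʳ-* (suc i) x z ⟩
      x ^ suc i * z ^ suc i          ≤⟨ *-monoˡ-≤ (z ^ suc i) (power-bound i) ⟩
      s 0 * y ^ i * z ^ suc i        ≡⟨ identity₂ (s 0) (y ^ i) (z ^ suc i) ⟩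
      s 0 * z ^ suc i * y ^ i        ∎)
      where
      open ≤-Reasoning
      x = s i
      y = s (suc i)
      z = s (suc (suc i))
      identity₁ : ∀ a b → a * (a * b) * b ≡ (a * b) * (a * b)
      identity₁ = solve-∀
      identity₂ : ∀ a b c → a * b * c ≡ a * c * b
      identity₂ = solve-∀

  -- The Cauchy–Schwarz inequality for the moments of a measure on the line.
  MomentLike : (ℕ → ℕ) → Set
  MomentLike c = ∀ a b → c (a + b) * c (a + b) ≤ c (a + a) * c (b + b)

  module _ {c : ℕ → ℕ} (mc : MomentLike c) where

    -- The indices `i` and `i + 2` add up to twice `i + 1`.
    even-logConvex : LogConvex (λ i → c (i + i))
    even-logConvex i = subst (λ j → c j * c j ≤ c (i + i) * c (suc (suc i) + suc (suc i)))
      (shift i) (mc i (suc (suc i)))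
      where
      shift : ∀ j → j + suc (suc j) ≡ suc j + suc j
      shift = solve-∀

    -- Starting the even subsequence at index 2 makes the extreme factor `c 2` instead of `c 0`.
    even-spread : ∀ p q → c (suc p + suc p) * c (suc q + suc q) ≤ c 2 * c (suc (p + q) + suc (p + q))
    even-spread = spread {λ i → c (suc i + suc i)} (λ i → even-logConvex (suc i))

    -- The square of an odd moment is at most the product of the two neighbouring even ones. The
    -- four even moments that result are regrouped crosswise, so that `even-spread` gives the same
    -- bound for both pairs.
    odd-spread : ∀ p q → c (suc p + suc (suc p)) * c (suc q + suc (suc q))
                         ≤ c 2 * c (suc (suc (p + q)) + suc (suc (p + q)))
    odd-spread p q = m²≤n²⇒m≤n _ _ (begin
      (x * y) * (x * y)          ≡⟨ identity x x y y ⟩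
      (x * x) * (y * y)          ≤⟨ *-mono-≤ (mc (suc p) (suc (suc p))) (mc (suc q) (suc (suc q))) ⟩
      (s (suc p) * s (suc (suc p))) * (s (suc q) * s (suc (suc q)))
        ≡⟨ identity′ (s (suc p)) (s (suc (suc p))) (s (suc q)) (s (suc (suc q))) ⟩
      (s (suc p) * s (suc (suc q))) * (s (suc (suc p)) * s (suc q))
        ≤⟨ *-mono-≤ (even-spread p (suc q)) (even-spread (suc p) q) ⟩
      (c 2 * s (suc (p + suc q))) * (c 2 * z)
        ≡⟨ cong (λ i → (c 2 * s (suc i)) * (c 2 * z)) (+-suc p q) ⟩
      (c 2 * z) * (c 2 * z)      ∎)
      where
      open ≤-Reasoning
      s : ℕ → ℕ
      s i = c (i + i)
      x = c (suc p + suc (suc p))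
      y = c (suc q + suc (suc q))
      z = s (suc (suc (p + q)))
      identity : ∀ a b d e → (a * d) * (b * e) ≡ (a * b) * (d * e)
      identity = solve-∀
      identity′ : ∀ a b d e → (a * b) * (d * e) ≡ (a * e) * (b * d)
      identity′ = solve-∀

    -- Among the splittings of an even length into two positive parts, 2 and the rest is extremal.
    -- The parts have equal parity. A part equal to 1 would bring in `c 0` through its even
    -- neighbours, and `c 1 ≡ 0` settles that case.
    moment-spread : c 1 ≡ 0 → ∀ h i j → suc i + suc j ≡ suc h + suc h →
                    c (suc i) * c (suc j) ≤ c 2 * c (h + h)
    moment-spread c1≡0 h i j eq with parity i | parity j
    ... | odd p | odd q = subst₂ _≤_
      (cong₂ (λ a b → c (suc a) * c (suc b)) (+-suc p p) (+-suc q q))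
      (cong (λ a → c 2 * c (a + a)) (suc-injective (m+m-injective (suc (suc (p + q))) (suc h) (trans (lemma p q) eq))))
      (even-spread p q)
      where
      lemma : ∀ p q → suc (suc (p + q)) + suc (suc (p + q)) ≡ suc (suc (p + p)) + suc (suc (q + q))
      lemma = solve-∀
    ... | odd p | even q = contradiction (trans (sym eq) (lemma p q)) (m+m≢1+n+n (suc h) (suc (p + q)))
      where
      lemma : ∀ p q → suc (suc (p + p)) + suc (q + q) ≡ suc (suc (p + q) + suc (p + q))
      lemma = solve-∀
    ... | even p | odd q = contradiction (trans (sym eq) (lemma p q)) (m+m≢1+n+n (suc h) (suc (p + q)))
      where
      lemma : ∀ p q → suc (p + p) + suc (suc (q + q)) ≡ suc (suc (p + q) + suc (p + q))
      lemma = solve-∀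
    ... | even zero | even q = ≤-trans (≤-reflexive (cong (_* c (suc (q + q))) c1≡0)) z≤n
    ... | even p@(suc _) | even zero =
      ≤-trans (≤-reflexive (trans (cong (c (suc (p + p)) *_) c1≡0) (*-zeroʳ (c (suc (p + p)))))) z≤n
    ... | even (suc p) | even (suc q) = subst₂ _≤_
      (cong₂ (λ a b → c a * c b) (+-suc (suc p) (suc p)) (+-suc (suc q) (suc q)))
      (cong (λ a → c 2 * c (a + a)) (suc-injective (m+m-injective (suc (suc (suc (p + q)))) (suc h) (trans (lemma p q) eq))))
      (odd-spread p q)
      where
      lemma : ∀ p q → suc (suc (suc (p + q))) + suc (suc (suc (p + q))) ≡ suc (suc p + suc p) + suc (suc q + suc q)
      lemma = solve-∀

open LogConvexity

-- Finite sums, the Cauchy-Schwarz inequality and the Kronecker delta.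

module Sums where

  open Data.Nat using (_*_)

  ∑ : {A : Set} → List A → (A → ℕ) → ℕ
  ∑ xs f = sum (map f xs)

  infixr 5 ∑
  syntax ∑ xs (λ x → e) = ∑[ x ∈ xs ] e

  ind : Bool → ℕ
  ind b = if b then 1 else 0

  module _ {A : Set} where

    ∑-cong : ∀ (xs : List A) {f g} → (∀ x → f x ≡ g x) → ∑ xs f ≡ ∑ xs g
    ∑-cong []       f≗g = refl
    ∑-cong (x ∷ xs) f≗g = cong₂ _+_ (f≗g x) (∑-cong xs f≗g)

    ∑-mono-≤ : ∀ (xs : List A) {f g} → (∀ x → f x ≤ g x) → ∑ xs f ≤ ∑ xs g
    ∑-mono-≤ []       f≤g = z≤n
    ∑-mono-≤ (x ∷ xs) f≤g = +-mono-≤ (f≤g x) (∑-mono-≤ xs f≤g)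

    ∑-distrib-+ : ∀ (xs : List A) f g → ∑[ x ∈ xs ] (f x + g x) ≡ ∑ xs f + ∑ xs g
    ∑-distrib-+ []       f g = refl
    ∑-distrib-+ (x ∷ xs) f g =
      trans (cong (f x + g x +_) (∑-distrib-+ xs f g)) (identity (f x) (g x) (∑ xs f) (∑ xs g))
      where
      identity : ∀ a b c d → a + b + (c + d) ≡ a + c + (b + d)
      identity = solve-∀

    ∑-distribˡ-* : ∀ c (xs : List A) f → ∑[ x ∈ xs ] c * f x ≡ c * ∑ xs f
    ∑-distribˡ-* c []       f = sym (*-zeroʳ c)
    ∑-distribˡ-* c (x ∷ xs) f =
      trans (cong (c * f x +_) (∑-distribˡ-* c xs f)) (sym (*-distribˡ-+ c (f x) (∑ xs f)))

    ∑-distribʳ-* : ∀ c (xs : List A) f → ∑[ x ∈ xs ] f x * c ≡ ∑ xs f * c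
    ∑-distribʳ-* c xs f =
      trans (∑-cong xs (λ x → *-comm (f x) c)) (trans (∑-distribˡ-* c xs f) (*-comm c (∑ xs f)))

    ∑-const : ∀ c (xs : List A) → ∑[ x ∈ xs ] c ≡ length xs * c
    ∑-const c []       = refl
    ∑-const c (x ∷ xs) = cong (c +_) (∑-const c xs)

    ∑-zero : ∀ (xs : List A) → ∑[ x ∈ xs ] 0 ≡ 0
    ∑-zero xs = trans (∑-const 0 xs) (*-zeroʳ (length xs))

    ∑-++ : ∀ (xs ys : List A) f → ∑ (xs ++ ys) f ≡ ∑ xs f + ∑ ys f
    ∑-++ xs ys f = trans (cong sum (map-++ f xs ys)) (sum-++ (map f xs) (map f ys))

    -- By induction on the list: the cross term 2aF is at most bH + cG, since (aF)² ≤ (bH)(cG). The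
    -- termwise hypothesis f² ≤ gh avoids roots and lets the inequality be nested for double sums.
    ∑-Cauchy-Schwarz : ∀ (xs : List A) f g h → (∀ x → f x * f x ≤ g x * h x) →
                       ∑ xs f * ∑ xs f ≤ ∑ xs g * ∑ xs h
    ∑-Cauchy-Schwarz []       f g h f²≤gh = z≤n
    ∑-Cauchy-Schwarz (x ∷ xs) f g h f²≤gh = begin
      (a + F) * (a + F)                  ≡⟨ identity₁ a F ⟩
      a * a + 2 * (a * F) + F * F        ≤⟨ +-mono-≤ (+-mono-≤ (f²≤gh x) cross) IH ⟩
      b * c + (b * H + c * G) + G * H    ≡⟨ identity₂ b c G H ⟩
      (b + G) * (c + H)                  ∎
      where
      open ≤-Reasoning
      a = f x
      b = g x
      c = h x
      F = ∑ xs f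
      G = ∑ xs g
      H = ∑ xs h
      IH : F * F ≤ G * H
      IH = ∑-Cauchy-Schwarz xs f g h f²≤gh
      identity₁ : ∀ a F → (a + F) * (a + F) ≡ a * a + 2 * (a * F) + F * F
      identity₁ = solve-∀
      identity₂ : ∀ b c G H → b * c + (b * H + c * G) + G * H ≡ (b + G) * (c + H)
      identity₂ = solve-∀
      identity₃ : ∀ a F → (a * F) * (a * F) ≡ (a * a) * (F * F)
      identity₃ = solve-∀
      identity₄ : ∀ b c G H → (b * c) * (G * H) ≡ (b * H) * (c * G)
      identity₄ = solve-∀
      cross : 2 * (a * F) ≤ b * H + c * G
      cross = o²≤mn⇒2o≤m+n {b * H} {c * G} {a * F} (begin
        (a * F) * (a * F)  ≡⟨ identity₃ a F ⟩
        (a * a) * (F * F)  ≤⟨ *-mono-≤ (f²≤gh x) IH ⟩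
        (b * c) * (G * H)  ≡⟨ identity₄ b c G H ⟩
        (b * H) * (c * G)  ∎)

  ∑-comm : ∀ {A B : Set} (xs : List A) (ys : List B) (f : A → B → ℕ) →
           ∑[ x ∈ xs ] ∑[ y ∈ ys ] f x y ≡ ∑[ y ∈ ys ] ∑[ x ∈ xs ] f x y
  ∑-comm []       ys f = sym (∑-zero ys)
  ∑-comm (x ∷ xs) ys f =
    trans (cong (∑ ys (f x) +_) (∑-comm xs ys f)) (sym (∑-distrib-+ ys (f x) (λ y → ∑[ x ∈ xs ] f x y)))

  ∑-upTo-suc : ∀ a f → ∑ (upTo (suc a)) f ≡ f 0 + (∑[ i ∈ upTo a ] f (suc i))
  ∑-upTo-suc a f = trans (cong sum (map-upTo f (suc a))) (cong (λ l → f 0 + sum l) (sym (map-upTo (f ∘ suc) a)))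

  ∑-upTo-mono-≤ : ∀ a {f g} → (∀ i → i < a → f i ≤ g i) → ∑ (upTo a) f ≤ ∑ (upTo a) g
  ∑-upTo-mono-≤ zero    f≤g = z≤n
  ∑-upTo-mono-≤ (suc a) {f} {g} f≤g = subst₂ _≤_ (sym (∑-upTo-suc a f)) (sym (∑-upTo-suc a g))
    (+-mono-≤ (f≤g 0 (s≤s z≤n)) (∑-upTo-mono-≤ a (λ i i<a → f≤g (suc i) (s≤s i<a))))

  module _ {n : ℕ} where

    𝟙 : Fin n → Fin n → ℕ
    𝟙 x y = ind ⌊ x Fin.≟ y ⌋

    𝟙-refl : ∀ x → 𝟙 x x ≡ 1
    𝟙-refl x with x Fin.≟ x
    ... | yes _  = refl
    ... | no x≢x = contradiction refl x≢x

    𝟙-≢ : ∀ {x y} → x ≢ y → 𝟙 x y ≡ 0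
    𝟙-≢ {x} {y} x≢y with x Fin.≟ y
    ... | yes x≡y = contradiction x≡y x≢y
    ... | no _    = refl

    𝟙-sym : ∀ x y → 𝟙 x y ≡ 𝟙 y x
    𝟙-sym x y with x Fin.≟ y
    ... | yes refl = sym (𝟙-refl x)
    ... | no x≢y   = sym (𝟙-≢ (x≢y ∘ sym))

  sum-tabulate-zero : ∀ {n} {f : Fin n → ℕ} → (∀ y → f y ≡ 0) → sum (tabulate f) ≡ 0
  sum-tabulate-zero {zero}  f≗0 = refl
  sum-tabulate-zero {suc n} f≗0 = cong₂ _+_ (f≗0 zero) (sum-tabulate-zero (f≗0 ∘ suc))

  sum-tabulate-single : ∀ {n} (x : Fin n) {f : Fin n → ℕ} → (∀ y → x ≢ y → f y ≡ 0) → sum (tabulate f) ≡ f x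
  sum-tabulate-single zero    {f} f≗0 =
    trans (cong (f zero +_) (sum-tabulate-zero (λ y → f≗0 (suc y) λ ()))) (+-identityʳ (f zero))
  sum-tabulate-single (suc x) f≗0 =
    cong₂ _+_ (f≗0 zero λ ()) (sum-tabulate-single x (λ y x≢y → f≗0 (suc y) (x≢y ∘ Fin-suc-injective)))
    where
    Fin-suc-injective : ∀ {n} {x y : Fin n} → Fin.suc x ≡ suc y → x ≡ y
    Fin-suc-injective refl = refl

  ∑-𝟙ˡ : ∀ {n} (x : Fin n) (f : Fin n → ℕ) → ∑[ y ∈ allFin n ] 𝟙 x y * f y ≡ f x
  ∑-𝟙ˡ x f = begin
    sum (map g (tabulate id))  ≡⟨ cong sum (map-tabulate id g) ⟩
    sum (tabulate g)           ≡⟨ sum-tabulate-single x (λ y x≢y → cong (_* f y) (𝟙-≢ x≢y)) ⟩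
    𝟙 x x * f x                ≡⟨ cong (_* f x) (𝟙-refl x) ⟩
    1 * f x                    ≡⟨ *-identityˡ (f x) ⟩
    f x                        ∎
    where
    open ≡-Reasoning
    g = λ y → 𝟙 x y * f y

  ∑-𝟙ʳ : ∀ {n} (x : Fin n) (f : Fin n → ℕ) → ∑[ y ∈ allFin n ] f y * 𝟙 y x ≡ f x
  ∑-𝟙ʳ {n} x f = trans
    (∑-cong (allFin n) (λ y → trans (*-comm (f y) (𝟙 y x)) (cong (_* f y) (𝟙-sym y x))))
    (∑-𝟙ˡ x f)

  -- `allSeqs` chooses the head in its inner loop; exchanging the sums lets walks be peeled from
  -- their first vertex.
  ∑-allSeqs-suc : ∀ m n (f : List (Fin n) → ℕ) → ∑ (allSeqs (suc m) n) f ≡ ∑[ x ∈ allFin n ] ∑[ xs ∈ allSeqs m n ] f (x ∷ xs)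
  ∑-allSeqs-suc m n f = trans (unfold (allSeqs m n)) (∑-comm (allSeqs m n) (allFin n) (λ xs x → f (x ∷ xs)))
    where
    unfold : ∀ S → ∑ (concatMap (λ xs → map (λ x → x ∷ xs) (allFin n)) S) f ≡ ∑[ xs ∈ S ] ∑[ x ∈ allFin n ] f (x ∷ xs)
    unfold []       = refl
    unfold (xs ∷ S) = trans (∑-++ (map (_∷ xs) (allFin n)) _ f)
      (cong₂ _+_ (cong sum (sym (map-∘ (allFin n)))) (unfold S))

  ∑-allSeqs-mono-≤ : ∀ m n {f g} → (∀ xs → length xs ≡ m → f xs ≤ g xs) →
                     ∑ (allSeqs m n) f ≤ ∑ (allSeqs m n) g
  ∑-allSeqs-mono-≤ zero    n f≤g = +-monoˡ-≤ 0 (f≤g [] refl)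
  ∑-allSeqs-mono-≤ (suc m) n {f} {g} f≤g = subst₂ _≤_ (sym (∑-allSeqs-suc m n f)) (sym (∑-allSeqs-suc m n g))
    (∑-mono-≤ (allFin n) λ x → ∑-allSeqs-mono-≤ m n λ xs |xs|≡m → f≤g (x ∷ xs) (cong suc |xs|≡m))

open Sums

-- The simple random walk in scaled form, its reversibility and its return weights.

module WeightedWalks {n : ℕ} (G : Graph n) (ω : Fin n → ℕ) (L : ℕ)
  (ω*degree≡L : ∀ x → ω x Data.Nat.* degree G x ≡ L) (degree≢0 : ∀ x → NonZero (degree G x)) where

  open Data.Nat using (_*_)

  V : List (Fin n)
  V = allFin n

  d : Fin n → ℕ
  d = degree G

  -- The transition matrix multiplied by `L`, as `ω x` stands for `L` / d(x).
  K : Fin n → Fin n → ℕ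
  K x y = ω x * ind (adj G x y)

  -- The matrix powers of `K`, that is, `L ^ a` times the transition probabilities in `a` steps.
  W : ℕ → Fin n → Fin n → ℕ
  W zero    x y = 𝟙 x y
  W (suc a) x y = ∑[ z ∈ V ] K x z * W a z y

  tr : ℕ → ℕ
  tr a = ∑[ x ∈ V ] W a x x

  ∑-K : ∀ x → ∑[ y ∈ V ] K x y ≡ L
  ∑-K x = trans (∑-distribˡ-* (ω x) V (λ y → ind (adj G x y))) (ω*degree≡L x)

  W-one : ∀ x y → W 1 x y ≡ K x y
  W-one x y = ∑-𝟙ʳ y (K x)

  W-+ : ∀ a b x y → W (a + b) x y ≡ ∑[ z ∈ V ] W a x z * W b z y
  W-+ zero    b x y = sym (∑-𝟙ˡ x (λ z → W b z y))
  W-+ (suc a) b x y = begin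
    ∑[ u ∈ V ] K x u * W (a + b) u y
      ≡⟨ ∑-cong V (λ u → cong (K x u *_) (W-+ a b u y)) ⟩
    ∑[ u ∈ V ] K x u * (∑[ z ∈ V ] W a u z * W b z y)
      ≡⟨ ∑-cong V (λ u → ∑-distribˡ-* (K x u) V (λ z → W a u z * W b z y)) ⟨
    ∑[ u ∈ V ] ∑[ z ∈ V ] K x u * (W a u z * W b z y)
      ≡⟨ ∑-comm V V (λ u z → K x u * (W a u z * W b z y)) ⟩
    ∑[ z ∈ V ] ∑[ u ∈ V ] K x u * (W a u z * W b z y)
      ≡⟨ ∑-cong V (λ z → ∑-cong V (λ u → *-assoc (K x u) (W a u z) (W b z y))) ⟨
    ∑[ z ∈ V ] ∑[ u ∈ V ] K x u * W a u z * W b z y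
      ≡⟨ ∑-cong V (λ z → ∑-distribʳ-* (W b z y) V (λ u → K x u * W a u z)) ⟩
    ∑[ z ∈ V ] W (suc a) x z * W b z y  ∎
    where open ≡-Reasoning

  W-sucʳ : ∀ a x y → W (suc a) x y ≡ ∑[ z ∈ V ] W a x z * K z y
  W-sucʳ a x y = begin
    W (suc a) x y                     ≡⟨ cong (λ b → W b x y) (+-comm 1 a) ⟩
    W (a + 1) x y                     ≡⟨ W-+ a 1 x y ⟩
    ∑[ z ∈ V ] W a x z * W 1 z y      ≡⟨ ∑-cong V (λ z → cong (W a x z *_) (W-one z y)) ⟩
    ∑[ z ∈ V ] W a x z * K z y        ∎
    where open ≡-Reasoning

  W-row-sum : ∀ a x → ∑[ y ∈ V ] W a x y ≡ L ^ a
  W-row-sum zero    x = trans (∑-cong V (λ y → sym (*-identityʳ (𝟙 x y)))) (∑-𝟙ˡ x (λ _ → 1))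
  W-row-sum (suc a) x = begin
    ∑[ y ∈ V ] ∑[ z ∈ V ] K x z * W a z y      ≡⟨ ∑-comm V V (λ y z → K x z * W a z y) ⟩
    ∑[ z ∈ V ] ∑[ y ∈ V ] K x z * W a z y      ≡⟨ ∑-cong V (λ z → ∑-distribˡ-* (K x z) V (W a z)) ⟩
    ∑[ z ∈ V ] K x z * (∑[ y ∈ V ] W a z y)    ≡⟨ ∑-cong V (λ z → cong (K x z *_) (W-row-sum a z)) ⟩
    ∑[ z ∈ V ] K x z * L ^ a                   ≡⟨ ∑-distribʳ-* (L ^ a) V (K x) ⟩
    (∑[ z ∈ V ] K x z) * L ^ a                 ≡⟨ cong (_* L ^ a) (∑-K x) ⟩
    L * L ^ a                                  ∎
    where open ≡-Reasoning

  -- Detailed balance: both sides equal `L` times the adjacency indicator, which is symmetric.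
  K-reversible : ∀ x y → d x * K x y ≡ d y * K y x
  K-reversible x y = begin
    d x * (ω x * ind (adj G x y))  ≡⟨ weight x (ind (adj G x y)) ⟩
    L * ind (adj G x y)            ≡⟨ cong (λ b → L * ind b) (Graph.sym G x y) ⟩
    L * ind (adj G y x)            ≡⟨ weight y (ind (adj G y x)) ⟨
    d y * (ω y * ind (adj G y x))  ∎
    where
    open ≡-Reasoning
    weight : ∀ x e → d x * (ω x * e) ≡ L * e
    weight x e = trans (sym (*-assoc (d x) (ω x) e))
      (cong (_* e) (trans (*-comm (d x) (ω x)) (ω*degree≡L x)))

  -- The degree factor is carried along the walk: detailed balance reverses the first step, the
  -- induction hypothesis the others, and the reversed first step is reattached at the end by
  -- `W-sucʳ`.
  W-reversible : ∀ a x y → d x * W a x y ≡ d y * W a y x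
  W-reversible zero x y with x Fin.≟ y
  ... | yes refl = cong (d x *_) (sym (𝟙-refl x))
  ... | no x≢y   = trans (*-zeroʳ (d x)) (sym (trans (cong (d y *_) (𝟙-≢ (x≢y ∘ sym))) (*-zeroʳ (d y))))
  W-reversible (suc a) x y = begin
    d x * (∑[ z ∈ V ] K x z * W a z y)    ≡⟨ ∑-distribˡ-* (d x) V (λ z → K x z * W a z y) ⟨
    ∑[ z ∈ V ] d x * (K x z * W a z y)    ≡⟨ ∑-cong V step ⟩
    ∑[ z ∈ V ] d y * (W a y z * K z x)    ≡⟨ ∑-distribˡ-* (d y) V (λ z → W a y z * K z x) ⟩
    d y * (∑[ z ∈ V ] W a y z * K z x)    ≡⟨ cong (d y *_) (W-sucʳ a y x) ⟨
    d y * W (suc a) y x                   ∎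
    where
    open ≡-Reasoning
    identity : ∀ a b c → (a * b) * c ≡ (a * c) * b
    identity = solve-∀
    step : ∀ z → d x * (K x z * W a z y) ≡ d y * (W a y z * K z x)
    step z = begin
      d x * (K x z * W a z y)  ≡⟨ *-assoc (d x) (K x z) (W a z y) ⟨
      d x * K x z * W a z y    ≡⟨ cong (_* W a z y) (K-reversible x z) ⟩
      d z * K z x * W a z y    ≡⟨ identity (d z) (K z x) (W a z y) ⟩
      d z * W a z y * K z x    ≡⟨ cong (_* K z x) (W-reversible a z y) ⟩
      d y * W a y z * K z x    ≡⟨ *-assoc (d y) (W a y z) (K z x) ⟩
      d y * (W a y z * K z x)  ∎

  -- Reversing both walks produces the same factor `d x * d y` on each side, and it is not zero.
  W-exchange : ∀ a b x y → W a x y * W b y x ≡ W a y x * W b x y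
  W-exchange a b x y = *-cancelˡ-≡ _ _ (d x * d y) {{m*n≢0 (d x) (d y) {{degree≢0 x}} {{degree≢0 y}}}} (begin
    d x * d y * (W a x y * W b y x)      ≡⟨ identity (d x) (d y) (W a x y) (W b y x) ⟩
    (d x * W a x y) * (d y * W b y x)    ≡⟨ cong₂ _*_ (W-reversible a x y) (W-reversible b y x) ⟩
    (d y * W a y x) * (d x * W b x y)    ≡⟨ identity (d y) (d x) (W a y x) (W b x y) ⟨
    d y * d x * (W a y x * W b x y)      ≡⟨ cong (_* (W a y x * W b x y)) (*-comm (d y) (d x)) ⟩
    d x * d y * (W a y x * W b x y)      ∎)
    where
    open ≡-Reasoning
    identity : ∀ a b c e → a * b * (c * e) ≡ (a * c) * (b * e)
    identity = solve-∀

  -- A closed walk is cut at the vertex `y` reached after `a` steps, and Cauchy-Schwarz is applied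
  -- over `y`; its termwise hypothesis holds with equality by `W-exchange`.
  W-momentLike : ∀ x → MomentLike (λ a → W a x x)
  W-momentLike x a b = subst₂ _≤_
    (sym (cong₂ _*_ (W-+ a b x x) (W-+ a b x x)))
    (sym (cong₂ _*_ (W-+ a a x x) (W-+ b b x x)))
    (∑-Cauchy-Schwarz V (λ y → W a x y * W b y x) (λ y → W a x y * W a y x) (λ y → W b x y * W b y x)
      λ y → ≤-reflexive (trans (cong (W a x y * W b y x *_) (W-exchange a b x y))
        (identity (W a x y) (W b y x) (W a y x) (W b x y))))
    where
    identity : ∀ p q r s → (p * q) * (r * s) ≡ (p * r) * (s * q)
    identity = solve-∀

  tr-momentLike : MomentLike tr
  tr-momentLike a b = ∑-Cauchy-Schwarz V (λ x → W (a + b) x x) (λ x → W (a + a) x x) (λ x → W (b + b) x x)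
    λ x → W-momentLike x a b

  tr-zero : tr 0 ≡ n
  tr-zero = begin
    ∑[ x ∈ V ] 𝟙 x x   ≡⟨ ∑-cong V 𝟙-refl ⟩
    ∑[ x ∈ V ] 1       ≡⟨ ∑-const 1 V ⟩
    length V * 1       ≡⟨ *-identityʳ (length V) ⟩
    length V           ≡⟨ length-tabulate id ⟩
    n                  ∎
    where open ≡-Reasoning

  -- Cauchy–Schwarz against the degrees, which form the stationary measure of the walk.
  tr-lower : .{{NonZero (∑ V d)}} → ∀ k → L ^ (k + k) ≤ tr (k + k)
  tr-lower k = *-cancelʳ-≤ _ _ (S * S) {{m*n≢0 S S}} (begin
    L ^ (k + k) * (S * S)          ≡⟨ cong (_* (S * S)) (^-distribˡ-+-* L k k) ⟩
    L ^ k * L ^ k * (S * S)        ≡⟨ identity (L ^ k) S ⟩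
    (S * L ^ k) * (S * L ^ k)      ≡⟨ cong₂ _*_ ∑f ∑f ⟨
    (∑[ x ∈ V ] F x) * (∑[ x ∈ V ] F x)
      ≤⟨ ∑-Cauchy-Schwarz V F T H (λ x → ∑-Cauchy-Schwarz V (f x) (t x) (h x) (λ y → ≤-reflexive (f²≡th x y))) ⟩
    (∑[ x ∈ V ] T x) * (∑[ x ∈ V ] H x)
      ≡⟨ cong₂ _*_ (∑-cong V (λ x → W-+ k k x x)) (sym ∑h) ⟨
    tr (k + k) * (S * S)           ∎)
    where
    open ≤-Reasoning
    S = ∑ V d
    f t h : Fin n → Fin n → ℕ
    f x y = d x * W k x y
    t x y = W k x y * W k y x
    h x y = d x * d y
    F T H : Fin n → ℕ
    F x = ∑ V (f x)
    T x = ∑ V (t x)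
    H x = ∑ V (h x)
    identity : ∀ a b → a * a * (b * b) ≡ (b * a) * (b * a)
    identity = solve-∀
    identity′ : ∀ a b c e → (a * b) * (c * e) ≡ (b * e) * (a * c)
    identity′ = solve-∀
    f²≡th : ∀ x y → f x y * f x y ≡ t x y * h x y
    f²≡th x y = trans (cong (f x y *_) (W-reversible k x y)) (identity′ (d x) (W k x y) (d y) (W k y x))
    ∑f : ∑ V F ≡ S * L ^ k
    ∑f = trans (∑-cong V (λ x → trans (∑-distribˡ-* (d x) V (W k x)) (cong (d x *_) (W-row-sum k x))))
      (∑-distribʳ-* (L ^ k) V d)
    ∑h : ∑ V H ≡ S * S
    ∑h = trans (∑-cong V (λ x → ∑-distribˡ-* (d x) V d)) (∑-distribʳ-* S V d)

  -- Upper bounds for closed walks that return at a prescribed time.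

  module _ (δ : ℕ) (δ≤d : ∀ x → δ ≤ d x) where

    ω*δ≤L : ∀ x → ω x * δ ≤ L
    ω*δ≤L x = ≤-trans (*-monoʳ-≤ (ω x) (δ≤d x)) (≤-reflexive (ω*degree≡L x))

    K*δ≤L : ∀ x y → K x y * δ ≤ L
    K*δ≤L x y with adj G x y
    ... | true  = ≤-trans (≤-reflexive (cong (_* δ) (*-identityʳ (ω x)))) (ω*δ≤L x)
    ... | false = ≤-trans (≤-reflexive (cong (_* δ) (*-zeroʳ (ω x)))) z≤n

    -- Whatever the first step is, the second one leads back to `x` with probability at most 1/δ.
    W₂*δ≤L² : ∀ x → W 2 x x * δ ≤ L * L
    W₂*δ≤L² x = begin
      W 2 x x * δ                              ≡⟨ ∑-distribʳ-* δ V (λ z → K x z * W 1 z x) ⟨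
      ∑[ z ∈ V ] K x z * W 1 z x * δ           ≡⟨ ∑-cong V (λ z → trans (*-assoc (K x z) (W 1 z x) δ) (cong (λ w → K x z * (w * δ)) (W-one z x))) ⟩
      ∑[ z ∈ V ] K x z * (K z x * δ)           ≤⟨ ∑-mono-≤ V (λ z → *-monoʳ-≤ (K x z) (K*δ≤L z x)) ⟩
      ∑[ z ∈ V ] K x z * L                     ≡⟨ ∑-distribʳ-* L V (K x) ⟩
      (∑[ z ∈ V ] K x z) * L                   ≡⟨ cong (_* L) (∑-K x) ⟩
      L * L                                    ∎
      where open ≤-Reasoning

    W₁≡0 : ∀ x → W 1 x x ≡ 0
    W₁≡0 x = trans (W-one x x) (trans (cong (λ b → ω x * ind b) (irrefl G x)) (*-zeroʳ (ω x)))

    double-return : ∀ h i j → suc i + suc j ≡ suc h + suc h →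
                    (∑[ x ∈ V ] W (suc i) x x * W (suc j) x x) * δ ≤ L * L * tr (h + h)
    double-return h i j eq = begin
      (∑[ x ∈ V ] W (suc i) x x * W (suc j) x x) * δ
        ≤⟨ *-monoˡ-≤ δ (∑-mono-≤ V (λ x → moment-spread {λ a → W a x x} (W-momentLike x) (W₁≡0 x) h i j eq)) ⟩
      (∑[ x ∈ V ] W 2 x x * W (h + h) x x) * δ
        ≡⟨ ∑-distribʳ-* δ V (λ x → W 2 x x * W (h + h) x x) ⟨
      ∑[ x ∈ V ] W 2 x x * W (h + h) x x * δ
        ≡⟨ ∑-cong V (λ x → identity (W 2 x x) (W (h + h) x x) δ) ⟩
      ∑[ x ∈ V ] W 2 x x * δ * W (h + h) x x
        ≤⟨ ∑-mono-≤ V (λ x → *-monoˡ-≤ (W (h + h) x x) (W₂*δ≤L² x)) ⟩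
      ∑[ x ∈ V ] L * L * W (h + h) x x
        ≡⟨ ∑-distribˡ-* (L * L) V (λ x → W (h + h) x x) ⟩
      L * L * tr (h + h)  ∎
      where
      open ≤-Reasoning
      identity : ∀ a b c → a * b * c ≡ a * c * b
      identity = solve-∀

    module _ .{{_ : NonZero (∑ V d)}} .{{_ : NonZero δ}} (c h : ℕ) (c^k*n≤δ^k : c ^ suc h * n ≤ δ ^ suc h) where

      private
        k = suc h
        T = tr (k + k)
        t = tr (h + h)

      -- Here c n^(1/k) ≤ δ, so the comparison is made between `k`-th powers. Log-convexity of the
      -- even traces gives t^k ≤ n T^h, and the missing factor `T` comes from L^(2k) ≤ T.
      tr-step : c * (L * L * t) ≤ δ * T
      tr-step = m^k≤n^k⇒m≤n h _ _ (begin
        (c * (L * L * t)) ^ k            ≡⟨ ^-distribʳ-* k c (L * L * t) ⟩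
        c ^ k * (L * L * t) ^ k          ≡⟨ cong (c ^ k *_) (^-distribʳ-* k (L * L) t) ⟩
        c ^ k * ((L * L) ^ k * t ^ k)    ≤⟨ *-monoʳ-≤ (c ^ k) (*-mono-≤ L²ᵏ≤T t^k≤) ⟩
        c ^ k * (T * (n * T ^ h))        ≡⟨ identity (c ^ k) T n (T ^ h) ⟩
        c ^ k * n * (T * T ^ h)          ≤⟨ *-monoˡ-≤ (T * T ^ h) c^k*n≤δ^k ⟩
        δ ^ k * T ^ k                    ≡⟨ ^-distribʳ-* k δ T ⟨
        (δ * T) ^ k                      ∎)
        where
        open ≤-Reasoning
        identity : ∀ a b c e → a * (b * (c * e)) ≡ a * c * (b * e)
        identity = solve-∀
        L²ᵏ≤T : (L * L) ^ k ≤ T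
        L²ᵏ≤T = ≤-trans (≤-reflexive (trans (^-distribʳ-* k L L) (sym (^-distribˡ-+-* L k k)))) (tr-lower k)
        t^k≤ : t ^ k ≤ n * T ^ h
        t^k≤ = ≤-trans (power-bound {λ i → tr (i + i)} (even-logConvex {tr} tr-momentLike) h)
          (≤-reflexive (cong (_* T ^ h) tr-zero))

      -- For one fixed pair of positions, closed walks with equal vertices there carry at most a
      -- fraction 1/c of the total weight.
      double-return-rare : ∀ i j → suc i + suc j ≡ k + k →
                           c * (∑[ x ∈ V ] W (suc i) x x * W (suc j) x x) ≤ T
      double-return-rare i j eq = *-cancelʳ-≤ _ _ δ (begin
        c * R * δ          ≡⟨ *-assoc c R δ ⟩
        c * (R * δ)        ≤⟨ *-monoʳ-≤ c (double-return h i j eq) ⟩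
        c * (L * L * t)    ≤⟨ tr-step ⟩
        δ * T              ≡⟨ *-comm δ T ⟩
        T * δ              ∎)
        where
        open ≤-Reasoning
        R = ∑[ x ∈ V ] W (suc i) x x * W (suc j) x x

  -- Walks as vertex lists, and counting their repeated vertices.

  walkWeight : Fin n → List (Fin n) → Fin n → ℕ
  walkWeight x []       z = K x z
  walkWeight x (y ∷ ys) z = K x y * walkWeight y ys z

  Seqs : ℕ → List (List (Fin n))
  Seqs a = allSeqs a n

  ∑-walkWeight : ∀ a x z → ∑[ xs ∈ Seqs a ] walkWeight x xs z ≡ W (suc a) x z
  ∑-walkWeight zero    x z = trans (+-identityʳ (K x z)) (sym (W-one x z))
  ∑-walkWeight (suc a) x z = begin
    ∑[ xs ∈ Seqs (suc a) ] walkWeight x xs z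
      ≡⟨ ∑-allSeqs-suc a n (λ xs → walkWeight x xs z) ⟩
    ∑[ y ∈ V ] ∑[ ys ∈ Seqs a ] K x y * walkWeight y ys z
      ≡⟨ ∑-cong V (λ y → trans (∑-distribˡ-* (K x y) (Seqs a) (λ ys → walkWeight y ys z))
                           (cong (K x y *_) (∑-walkWeight a y z))) ⟩
    W (suc (suc a)) x z  ∎
    where open ≡-Reasoning

  occurrences : Fin n → List (Fin n) → ℕ
  occurrences u xs = ∑ xs (𝟙 u)

  -- Pairs of positions with equal entries, counted with multiplicity so that a union bound can
  -- treat each pair on its own.
  repetitions : List (Fin n) → ℕ
  repetitions []       = 0
  repetitions (x ∷ xs) = occurrences x xs + repetitions xs

  -- Cutting the walk where `u` stands at position `i` of the interior leaves two independent walks,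
  -- of lengths `suc i` and `a ∸ i`.
  ∑-occurrences : ∀ a u x z → ∑[ xs ∈ Seqs a ] occurrences u xs * walkWeight x xs z
                              ≡ ∑[ i ∈ upTo a ] W (suc i) x u * W (a ∸ i) u z
  ∑-occurrences zero    u x z = refl
  ∑-occurrences (suc a) u x z = begin
    ∑[ xs ∈ Seqs (suc a) ] occurrences u xs * walkWeight x xs z
      ≡⟨ ∑-allSeqs-suc a n (λ xs → occurrences u xs * walkWeight x xs z) ⟩
    ∑[ y ∈ V ] ∑[ ys ∈ Seqs a ] (𝟙 u y + occurrences u ys) * (K x y * walkWeight y ys z)
      ≡⟨ ∑-cong V split ⟩
    ∑[ y ∈ V ] (𝟙 u y * (K x y * W (suc a) y z) + K x y * later y)
      ≡⟨ ∑-distrib-+ V (λ y → 𝟙 u y * (K x y * W (suc a) y z)) (λ y → K x y * later y) ⟩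
    (∑[ y ∈ V ] 𝟙 u y * (K x y * W (suc a) y z)) + (∑[ y ∈ V ] K x y * later y)
      ≡⟨ cong₂ _+_ (∑-𝟙ˡ u (λ y → K x y * W (suc a) y z)) rest ⟩
    K x u * W (suc a) u z + (∑[ i ∈ upTo a ] W (suc (suc i)) x u * W (a ∸ i) u z)
      ≡⟨ cong (λ w → w * W (suc a) u z + (∑[ i ∈ upTo a ] W (suc (suc i)) x u * W (a ∸ i) u z)) (W-one x u) ⟨
    W 1 x u * W (suc a) u z + (∑[ i ∈ upTo a ] W (suc (suc i)) x u * W (a ∸ i) u z)
      ≡⟨ ∑-upTo-suc a (λ i → W (suc i) x u * W (suc a ∸ i) u z) ⟨
    ∑[ i ∈ upTo (suc a) ] W (suc i) x u * W (suc a ∸ i) u z  ∎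
    where
    open ≡-Reasoning
    later : Fin n → ℕ
    later y = ∑[ ys ∈ Seqs a ] occurrences u ys * walkWeight y ys z
    identity : ∀ p q r s → (p + q) * (r * s) ≡ p * (r * s) + r * (q * s)
    identity = solve-∀
    split : ∀ y → ∑[ ys ∈ Seqs a ] (𝟙 u y + occurrences u ys) * (K x y * walkWeight y ys z)
                  ≡ 𝟙 u y * (K x y * W (suc a) y z) + K x y * later y
    split y = begin
      ∑[ ys ∈ Seqs a ] (𝟙 u y + occurrences u ys) * (K x y * walkWeight y ys z)
        ≡⟨ ∑-cong (Seqs a) (λ ys → identity (𝟙 u y) (occurrences u ys) (K x y) (walkWeight y ys z)) ⟩
      ∑[ ys ∈ Seqs a ] (𝟙 u y * (K x y * walkWeight y ys z) + K x y * (occurrences u ys * walkWeight y ys z))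
        ≡⟨ ∑-distrib-+ (Seqs a) (λ ys → 𝟙 u y * (K x y * walkWeight y ys z)) (λ ys → K x y * (occurrences u ys * walkWeight y ys z)) ⟩
      (∑[ ys ∈ Seqs a ] 𝟙 u y * (K x y * walkWeight y ys z)) + (∑[ ys ∈ Seqs a ] K x y * (occurrences u ys * walkWeight y ys z))
        ≡⟨ cong₂ _+_
             (trans (∑-distribˡ-* (𝟙 u y) (Seqs a) (λ ys → K x y * walkWeight y ys z))
               (cong (𝟙 u y *_) (trans (∑-distribˡ-* (K x y) (Seqs a) (λ ys → walkWeight y ys z))
                 (cong (K x y *_) (∑-walkWeight a y z)))))
             (∑-distribˡ-* (K x y) (Seqs a) (λ ys → occurrences u ys * walkWeight y ys z)) ⟩
      𝟙 u y * (K x y * W (suc a) y z) + K x y * later y  ∎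
    rest : ∑[ y ∈ V ] K x y * later y ≡ ∑[ i ∈ upTo a ] W (suc (suc i)) x u * W (a ∸ i) u z
    rest = begin
      ∑[ y ∈ V ] K x y * later y
        ≡⟨ ∑-cong V (λ y → cong (K x y *_) (∑-occurrences a u y z)) ⟩
      ∑[ y ∈ V ] K x y * (∑[ i ∈ upTo a ] W (suc i) y u * W (a ∸ i) u z)
        ≡⟨ ∑-cong V (λ y → ∑-distribˡ-* (K x y) (upTo a) (λ i → W (suc i) y u * W (a ∸ i) u z)) ⟨
      ∑[ y ∈ V ] ∑[ i ∈ upTo a ] K x y * (W (suc i) y u * W (a ∸ i) u z)
        ≡⟨ ∑-comm V (upTo a) (λ y i → K x y * (W (suc i) y u * W (a ∸ i) u z)) ⟩
      ∑[ i ∈ upTo a ] ∑[ y ∈ V ] K x y * (W (suc i) y u * W (a ∸ i) u z)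
        ≡⟨ ∑-cong (upTo a) (λ i → trans
             (∑-cong V (λ y → sym (*-assoc (K x y) (W (suc i) y u) (W (a ∸ i) u z))))
             (∑-distribʳ-* (W (a ∸ i) u z) V (λ y → K x y * W (suc i) y u))) ⟩
      ∑[ i ∈ upTo a ] W (suc (suc i)) x u * W (a ∸ i) u z  ∎

  repeatingWalks : ℕ → Fin n → Fin n → ℕ
  repeatingWalks a x z = ∑[ xs ∈ Seqs a ] repetitions (x ∷ xs) * walkWeight x xs z

  returningWalks : ℕ → Fin n → Fin n → ℕ
  returningWalks a x z = ∑[ i ∈ upTo a ] W (suc i) x x * W (a ∸ i) x z

  -- A repeated pair either involves the first vertex or survives when the first step is removed.
  repeatingWalks-suc : ∀ a x z → repeatingWalks (suc a) x z
                                 ≡ returningWalks (suc a) x z + (∑[ y ∈ V ] K x y * repeatingWalks a y z)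
  repeatingWalks-suc a x z = begin
    ∑[ xs ∈ Seqs (suc a) ] (occurrences x xs + repetitions xs) * walkWeight x xs z
      ≡⟨ ∑-cong (Seqs (suc a)) (λ xs → *-distribʳ-+ (walkWeight x xs z) (occurrences x xs) (repetitions xs)) ⟩
    ∑[ xs ∈ Seqs (suc a) ] (occurrences x xs * walkWeight x xs z + repetitions xs * walkWeight x xs z)
      ≡⟨ ∑-distrib-+ (Seqs (suc a)) (λ xs → occurrences x xs * walkWeight x xs z) (λ xs → repetitions xs * walkWeight x xs z) ⟩
    (∑[ xs ∈ Seqs (suc a) ] occurrences x xs * walkWeight x xs z) + (∑[ xs ∈ Seqs (suc a) ] repetitions xs * walkWeight x xs z)
      ≡⟨ cong₂ _+_ (∑-occurrences (suc a) x x z) rest ⟩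
    returningWalks (suc a) x z + (∑[ y ∈ V ] K x y * repeatingWalks a y z)  ∎
    where
    open ≡-Reasoning
    identity : ∀ p q r → p * (q * r) ≡ q * (p * r)
    identity = solve-∀
    rest : ∑[ xs ∈ Seqs (suc a) ] repetitions xs * walkWeight x xs z ≡ ∑[ y ∈ V ] K x y * repeatingWalks a y z
    rest = trans (∑-allSeqs-suc a n (λ xs → repetitions xs * walkWeight x xs z)) (∑-cong V (λ y → trans
      (∑-cong (Seqs a) (λ ys → identity (repetitions (y ∷ ys)) (K x y) (walkWeight y ys z)))
      (∑-distribˡ-* (K x y) (Seqs a) (λ ys → repetitions (y ∷ ys) * walkWeight y ys z))))

  -- Closed walks of length 1 + a + b, with their repetitions counted among the first 1 + a vertices only.
  repeating : ℕ → ℕ → ℕ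
  repeating a b = ∑[ x ∈ V ] ∑[ z ∈ V ] W b z x * repeatingWalks a x z

  returning : ℕ → ℕ → ℕ
  returning a b = ∑[ x ∈ V ] ∑[ z ∈ V ] W b z x * returningWalks a x z

  repeating-zero : ∀ b → repeating 0 b ≡ 0
  repeating-zero b =
    trans (∑-cong V (λ x → trans (∑-cong V (λ z → *-zeroʳ (W b z x))) (∑-zero V))) (∑-zero V)

  -- Pairs that avoid the first vertex are kept by rotating the closed walk: its first step is
  -- appended to the closing walk, whose length grows from `b` to `suc b`.
  repeating-suc : ∀ a b → repeating (suc a) b ≡ returning (suc a) b + repeating a (suc b)
  repeating-suc a b = begin
    ∑[ x ∈ V ] ∑[ z ∈ V ] W b z x * repeatingWalks (suc a) x z
      ≡⟨ ∑-cong V (λ x → trans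
           (∑-cong V (λ z → trans (cong (W b z x *_) (repeatingWalks-suc a x z))
             (*-distribˡ-+ (W b z x) (returningWalks (suc a) x z) (next x z))))
           (∑-distrib-+ V (λ z → W b z x * returningWalks (suc a) x z) (λ z → W b z x * next x z))) ⟩
    ∑[ x ∈ V ] ((∑[ z ∈ V ] W b z x * returningWalks (suc a) x z) + (∑[ z ∈ V ] W b z x * next x z))
      ≡⟨ ∑-distrib-+ V (λ x → ∑[ z ∈ V ] W b z x * returningWalks (suc a) x z) (λ x → ∑[ z ∈ V ] W b z x * next x z) ⟩
    returning (suc a) b + (∑[ x ∈ V ] ∑[ z ∈ V ] W b z x * next x z)
      ≡⟨ cong (returning (suc a) b +_) rest ⟩
    returning (suc a) b + repeating a (suc b)  ∎
    where
    open ≡-Reasoning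
    next : Fin n → Fin n → ℕ
    next x z = ∑[ y ∈ V ] K x y * repeatingWalks a y z
    absorb : ∀ z → ∑[ x ∈ V ] W b z x * next x z ≡ ∑[ y ∈ V ] W (suc b) z y * repeatingWalks a y z
    absorb z = begin
      ∑[ x ∈ V ] W b z x * next x z
        ≡⟨ ∑-cong V (λ x → ∑-distribˡ-* (W b z x) V (λ y → K x y * repeatingWalks a y z)) ⟨
      ∑[ x ∈ V ] ∑[ y ∈ V ] W b z x * (K x y * repeatingWalks a y z)
        ≡⟨ ∑-comm V V (λ x y → W b z x * (K x y * repeatingWalks a y z)) ⟩
      ∑[ y ∈ V ] ∑[ x ∈ V ] W b z x * (K x y * repeatingWalks a y z)
        ≡⟨ ∑-cong V (λ y → trans
             (∑-cong V (λ x → sym (*-assoc (W b z x) (K x y) (repeatingWalks a y z))))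
             (trans (∑-distribʳ-* (repeatingWalks a y z) V (λ x → W b z x * K x y))
               (cong (_* repeatingWalks a y z) (sym (W-sucʳ b z y))))) ⟩
      ∑[ y ∈ V ] W (suc b) z y * repeatingWalks a y z  ∎
    rest : ∑[ x ∈ V ] ∑[ z ∈ V ] W b z x * next x z ≡ repeating a (suc b)
    rest = trans (∑-comm V V (λ x z → W b z x * next x z))
      (trans (∑-cong V absorb) (∑-comm V V (λ z y → W (suc b) z y * repeatingWalks a y z)))

  -- After the return to `x`, the remaining `a ∸ i` steps and the closing walk join into a single
  -- closed walk at `x`.
  returning-splits : ∀ a b → returning a b ≡ ∑[ i ∈ upTo a ] ∑[ x ∈ V ] W (suc i) x x * W ((a ∸ i) + b) x x
  returning-splits a b = begin
    ∑[ x ∈ V ] ∑[ z ∈ V ] W b z x * returningWalks a x z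
      ≡⟨ ∑-cong V split ⟩
    ∑[ x ∈ V ] ∑[ i ∈ upTo a ] W (suc i) x x * W ((a ∸ i) + b) x x
      ≡⟨ ∑-comm V (upTo a) (λ x i → W (suc i) x x * W ((a ∸ i) + b) x x) ⟩
    ∑[ i ∈ upTo a ] ∑[ x ∈ V ] W (suc i) x x * W ((a ∸ i) + b) x x  ∎
    where
    open ≡-Reasoning
    identity : ∀ p q r → p * (q * r) ≡ q * (r * p)
    identity = solve-∀
    split : ∀ x → ∑[ z ∈ V ] W b z x * returningWalks a x z ≡ ∑[ i ∈ upTo a ] W (suc i) x x * W ((a ∸ i) + b) x x
    split x = begin
      ∑[ z ∈ V ] W b z x * returningWalks a x z
        ≡⟨ ∑-cong V (λ z → ∑-distribˡ-* (W b z x) (upTo a) (λ i → W (suc i) x x * W (a ∸ i) x z)) ⟨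
      ∑[ z ∈ V ] ∑[ i ∈ upTo a ] W b z x * (W (suc i) x x * W (a ∸ i) x z)
        ≡⟨ ∑-comm V (upTo a) (λ z i → W b z x * (W (suc i) x x * W (a ∸ i) x z)) ⟩
      ∑[ i ∈ upTo a ] ∑[ z ∈ V ] W b z x * (W (suc i) x x * W (a ∸ i) x z)
        ≡⟨ ∑-cong (upTo a) (λ i → trans
             (∑-cong V (λ z → identity (W b z x) (W (suc i) x x) (W (a ∸ i) x z)))
             (trans (∑-distribˡ-* (W (suc i) x x) V (λ z → W (a ∸ i) x z * W b z x))
               (cong (W (suc i) x x *_) (sym (W-+ (a ∸ i) b x x))))) ⟩
      ∑[ i ∈ upTo a ] W (suc i) x x * W ((a ∸ i) + b) x x  ∎

  module _ (N c T : ℕ)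
    (return-rare : ∀ i j → suc i + suc j ≡ N → c * (∑[ x ∈ V ] W (suc i) x x * W (suc j) x x) ≤ T) where

    returning-bound : ∀ a b → suc a + b ≡ N → c * returning a b ≤ N * T
    returning-bound a b eq = begin
      c * returning a b           ≡⟨ cong (c *_) (returning-splits a b) ⟩
      c * (∑[ i ∈ upTo a ] R i)   ≡⟨ ∑-distribˡ-* c (upTo a) R ⟨
      ∑[ i ∈ upTo a ] c * R i     ≤⟨ ∑-upTo-mono-≤ a bound ⟩
      ∑[ i ∈ upTo a ] T           ≡⟨ ∑-const T (upTo a) ⟩
      length (upTo a) * T         ≡⟨ cong (_* T) (length-upTo a) ⟩
      a * T                       ≤⟨ *-monoˡ-≤ T (≤-trans (n≤1+n a) (m+n≤o⇒m≤o (suc a) (≤-reflexive eq))) ⟩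
      N * T                       ∎
      where
      open ≤-Reasoning
      R : ℕ → ℕ
      R i = ∑[ x ∈ V ] W (suc i) x x * W ((a ∸ i) + b) x x
      bound : ∀ i → i < a → c * R i ≤ T
      -- Writing `a` as `suc i + o` turns `a ∸ i` into `suc o`, the positive second length that
      -- `return-rare` expects.
      bound i i<a with m≤n⇒∃[o]m+o≡n i<a
      ... | o , refl rewrite trans (cong (_∸ i) (sym (+-suc i o))) (m+n∸m≡n i (suc o)) =
        return-rare i (o + b) (trans (identity i o b) eq)
        where
        identity : ∀ i o b → suc i + suc (o + b) ≡ suc (suc i + o) + b
        identity = solve-∀

    -- Each rotation splits off the pairs of one starting vertex, at a cost of at most `N * T`;
    -- after `a` rotations no pair is left.
    repeating-bound : ∀ a b → suc a + b ≡ N → c * repeating a b ≤ a * (N * T)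
    repeating-bound zero    b eq = ≤-reflexive (trans (cong (c *_) (repeating-zero b)) (*-zeroʳ c))
    repeating-bound (suc a) b eq = begin
      c * repeating (suc a) b                            ≡⟨ cong (c *_) (repeating-suc a b) ⟩
      c * (returning (suc a) b + repeating a (suc b))    ≡⟨ *-distribˡ-+ c (returning (suc a) b) (repeating a (suc b)) ⟩
      c * returning (suc a) b + c * repeating a (suc b)
        ≤⟨ +-mono-≤ (returning-bound (suc a) b eq) (repeating-bound a (suc b) (trans (+-suc (suc a) b) eq)) ⟩
      N * T + a * (N * T)                                ∎
      where open ≤-Reasoning

  -- A closing walk of length 0 forces `z = x`.
  ∑-repeatingWalks : ∀ a → ∑[ x ∈ V ] repeatingWalks a x x ≡ repeating a 0
  ∑-repeatingWalks a = ∑-cong V λ x → sym (trans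
    (∑-cong V (λ z → cong (_* repeatingWalks a x z) (𝟙-sym z x))) (∑-𝟙ˡ x (repeatingWalks a x)))

  -- From closed walks to cycles.

  weight : List (Fin n) → ℕ
  weight []       = 1
  weight (x ∷ xs) = ω x * weight xs

  ind-∧ : ∀ p q → ind (p ∧ q) ≡ ind p * ind q
  ind-∧ true  q = sym (*-identityˡ (ind q))
  ind-∧ false q = refl

  -- The endpoint `z` contributes an edge but no factor `ω`. For `z = x` every position is thus
  -- weighed once, and the indicator is that of `closedWalk`.
  walkWeight-weight : ∀ x xs z → walkWeight x xs z ≡ ind (consecAdj G ((x ∷ xs) ++ [ z ])) * weight (x ∷ xs)
  walkWeight-weight x []       z = begin
    ω x * ind (adj G x z)                  ≡⟨ identity (ω x) (ind (adj G x z)) ⟩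
    ind (adj G x z) * 1 * (ω x * 1)        ≡⟨ cong (_* (ω x * 1)) (ind-∧ (adj G x z) true) ⟨
    ind (adj G x z ∧ true) * (ω x * 1)     ∎
    where
    open ≡-Reasoning
    identity : ∀ a b → a * b ≡ b * 1 * (a * 1)
    identity = solve-∀
  walkWeight-weight x (y ∷ ys) z = begin
    ω x * p * walkWeight y ys z            ≡⟨ cong (ω x * p *_) (walkWeight-weight y ys z) ⟩
    ω x * p * (ind rest * w)               ≡⟨ identity (ω x) p (ind rest) w ⟩
    p * ind rest * (ω x * w)               ≡⟨ cong (_* (ω x * w)) (ind-∧ (adj G x y) rest) ⟨
    ind (adj G x y ∧ rest) * (ω x * w)     ∎
    where
    open ≡-Reasoning
    p = ind (adj G x y)
    rest = consecAdj G ((y ∷ ys) ++ [ z ])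
    w = weight (y ∷ ys)
    identity : ∀ a b c e → a * b * (c * e) ≡ b * c * (a * e)
    identity = solve-∀

  any-ind : ∀ (p : Fin n → Bool) xs → ind (any p xs) ≤ ∑[ x ∈ xs ] ind (p x)
  any-ind p []       = z≤n
  any-ind p (x ∷ xs) with p x
  ... | true  = s≤s z≤n
  ... | false = any-ind p xs

  -- The union bound: a list whose entries are not distinct has at least one repeated pair.
  distinct-or-repeating : ∀ xs → 1 ≤ ind (allDistinct xs) + repetitions xs
  distinct-or-repeating []       = s≤s z≤n
  distinct-or-repeating (x ∷ xs) with any (λ y → ⌊ x Fin.≟ y ⌋) xs | any-ind (λ y → ⌊ x Fin.≟ y ⌋) xs
  ... | true  | 1≤occ = ≤-trans 1≤occ (m≤m+n (occurrences x xs) (repetitions xs))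
  ... | false | _     = ≤-trans (distinct-or-repeating xs)
    (+-monoʳ-≤ (ind (allDistinct xs)) (m≤n+m (repetitions xs) (occurrences x xs)))

  isCycle : List (Fin n) → Bool
  isCycle xs = allDistinct xs ∧ closedWalk G xs

  cycleWeight : ℕ → ℕ
  cycleWeight m = ∑[ xs ∈ Seqs m ] ind (isCycle xs) * weight xs

  tr≤cycles+repeating : ∀ m → tr (suc m) ≤ cycleWeight (suc m) + repeating m 0
  tr≤cycles+repeating m = begin
    ∑[ x ∈ V ] W (suc m) x x
      ≡⟨ ∑-cong V (λ x → ∑-walkWeight m x x) ⟨
    ∑[ x ∈ V ] ∑[ xs ∈ Seqs m ] walkWeight x xs x
      ≤⟨ ∑-mono-≤ V (λ x → ∑-mono-≤ (Seqs m) (split x)) ⟩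
    ∑[ x ∈ V ] ∑[ xs ∈ Seqs m ] (cyc x xs + rep x xs)
      ≡⟨ ∑-cong V (λ x → ∑-distrib-+ (Seqs m) (cyc x) (rep x)) ⟩
    ∑[ x ∈ V ] ((∑[ xs ∈ Seqs m ] cyc x xs) + repeatingWalks m x x)
      ≡⟨ ∑-distrib-+ V (λ x → ∑ (Seqs m) (cyc x)) (λ x → repeatingWalks m x x) ⟩
    (∑[ x ∈ V ] ∑[ xs ∈ Seqs m ] cyc x xs) + (∑[ x ∈ V ] repeatingWalks m x x)
      ≡⟨ cong₂ _+_ (sym (∑-allSeqs-suc m n (λ xs → ind (isCycle xs) * weight xs))) (∑-repeatingWalks m) ⟩
    cycleWeight (suc m) + repeating m 0  ∎
    where
    open ≤-Reasoning
    cyc rep : Fin n → List (Fin n) → ℕ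
    cyc x xs = ind (isCycle (x ∷ xs)) * weight (x ∷ xs)
    rep x xs = repetitions (x ∷ xs) * walkWeight x xs x
    split : ∀ x xs → walkWeight x xs x ≤ cyc x xs + rep x xs
    split x xs = begin
      w                                    ≡⟨ *-identityˡ w ⟨
      1 * w                                ≤⟨ *-monoˡ-≤ w (distinct-or-repeating (x ∷ xs)) ⟩
      (ind dist + repetitions (x ∷ xs)) * w
        ≡⟨ *-distribʳ-+ w (ind dist) (repetitions (x ∷ xs)) ⟩
      ind dist * w + rep x xs              ≡⟨ cong (λ v → ind dist * v + rep x xs) (walkWeight-weight x xs x) ⟩
      ind dist * (ind closed * weight (x ∷ xs)) + rep x xs
        ≡⟨ cong (_+ rep x xs) (*-assoc (ind dist) (ind closed) (weight (x ∷ xs))) ⟨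
      ind dist * ind closed * weight (x ∷ xs) + rep x xs
        ≡⟨ cong (λ v → v * weight (x ∷ xs) + rep x xs) (ind-∧ dist closed) ⟨
      cyc x xs + rep x xs                  ∎
      where
      w = walkWeight x xs x
      dist = allDistinct (x ∷ xs)
      closed = closedWalk G (x ∷ xs)

  module _ (δ : ℕ) (δ≤d : ∀ x → δ ≤ d x) where

    weight*δ^≤L^ : ∀ xs → weight xs * δ ^ length xs ≤ L ^ length xs
    weight*δ^≤L^ []       = ≤-refl
    weight*δ^≤L^ (x ∷ xs) = ≤-trans
      (≤-reflexive (identity (ω x) (weight xs) δ (δ ^ length xs)))
      (*-mono-≤ (ω*δ≤L δ δ≤d x) (weight*δ^≤L^ xs))
      where
      identity : ∀ a b c e → a * b * (c * e) ≡ a * c * (b * e)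
      identity = solve-∀

    -- A single cycle weighs at most (L/δ)^m, so a large total weight forces a large number of
    -- cycles.
    cycleWeight-bound : ∀ m → cycleWeight m * δ ^ m ≤ count isCycle (Seqs m) * L ^ m
    cycleWeight-bound m = begin
      cycleWeight m * δ ^ m
        ≡⟨ ∑-distribʳ-* (δ ^ m) (Seqs m) (λ xs → ind (isCycle xs) * weight xs) ⟨
      ∑[ xs ∈ Seqs m ] ind (isCycle xs) * weight xs * δ ^ m
        ≤⟨ ∑-allSeqs-mono-≤ m n (λ { xs refl → ≤-trans
             (≤-reflexive (*-assoc (ind (isCycle xs)) (weight xs) (δ ^ m)))
             (*-monoʳ-≤ (ind (isCycle xs)) (weight*δ^≤L^ xs)) }) ⟩
      ∑[ xs ∈ Seqs m ] ind (isCycle xs) * L ^ m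
        ≡⟨ ∑-distribʳ-* (L ^ m) (Seqs m) (λ xs → ind (isCycle xs)) ⟩
      count isCycle (Seqs m) * L ^ m  ∎
      where open ≤-Reasoning

    module _ .{{_ : NonZero (∑ V d)}} .{{_ : NonZero δ}} .{{_ : NonZero L}} (h : ℕ)
      (large : (64 * suc h * suc h) ^ suc h * n ≤ δ ^ suc h) where

      private
        k = suc h
        m = h + suc h
        T = tr (k + k)

      -- There are fewer than 4k² pairs of positions, so repetitions account for at most T / 16.
      repeating-rare : 16 * repeating m 0 ≤ T
      repeating-rare = *-cancelʳ-≤ _ _ (4 * k * k) (begin
        16 * R * (4 * k * k)     ≡⟨ identity₁ k R ⟩
        64 * k * k * R           ≤⟨ repeating-bound (k + k) (64 * k * k) T
                                      (double-return-rare δ δ≤d (64 * k * k) h large) m 0 (+-identityʳ (suc m)) ⟩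
        m * ((k + k) * T)        ≤⟨ *-monoˡ-≤ ((k + k) * T) (n≤1+n m) ⟩
        (k + k) * ((k + k) * T)  ≡⟨ identity₂ k T ⟩
        T * (4 * k * k)          ∎)
        where
        open ≤-Reasoning
        R = repeating m 0
        identity₁ : ∀ k R → 16 * R * (4 * k * k) ≡ 64 * k * k * R
        identity₁ = solve-∀
        identity₂ : ∀ k T → (k + k) * ((k + k) * T) ≡ T * (4 * k * k)
        identity₂ = solve-∀

      -- Repetitions account for at most half of `T`, and the cycles must supply the other half.
      tr≤2*cycleWeight : T ≤ 2 * cycleWeight (k + k)
      tr≤2*cycleWeight = +-cancelʳ-≤ T T (2 * C) (begin
        T + T              ≡⟨ double T ⟩
        2 * T              ≤⟨ *-monoʳ-≤ 2 (tr≤cycles+repeating m) ⟩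
        2 * (C + R)        ≡⟨ *-distribˡ-+ 2 C R ⟩
        2 * C + 2 * R      ≤⟨ +-monoʳ-≤ (2 * C) (≤-trans (*-monoˡ-≤ R {2} {16} (s≤s (s≤s z≤n))) repeating-rare) ⟩
        2 * C + T          ∎)
        where
        open ≤-Reasoning
        C = cycleWeight (k + k)
        R = repeating m 0
        double : ∀ x → x + x ≡ 2 * x
        double = solve-∀

      -- The chain is L^(2k) ≤ T ≤ 2C, where the cycle weight `C` is at most the number of labelled
      -- cycles times (L/δ)^(2k); the powers of `L` cancel.
      manyCycles : δ ^ (k + k) ≤ 2 * count isCycle (Seqs (k + k))
      manyCycles = *-cancelʳ-≤ _ _ (L ^ N) {{m^n≢0 L N}} (begin
        δ ^ N * L ^ N              ≤⟨ *-monoʳ-≤ (δ ^ N) (≤-trans (tr-lower k) tr≤2*cycleWeight) ⟩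
        δ ^ N * (2 * C)            ≡⟨ identity (δ ^ N) C ⟩
        2 * (C * δ ^ N)            ≤⟨ *-monoʳ-≤ 2 (cycleWeight-bound N) ⟩
        2 * (# * L ^ N)            ≡⟨ *-assoc 2 # (L ^ N) ⟨
        2 * # * L ^ N              ∎)
        where
        open ≤-Reasoning
        N = k + k
        C = cycleWeight N
        # = count isCycle (Seqs N)
        identity : ∀ a b → a * (2 * b) ≡ 2 * (b * a)
        identity = solve-∀

-- The cycle count over the natural numbers.

module Supersaturation where

  open Data.Nat using (_*_)

  argmin : ∀ {n} (f : Fin (suc n) → ℕ) → ∃ λ v → ∀ w → f v ≤ f w
  argmin {zero}  f = zero , λ { zero → ≤-refl }
  argmin {suc n} f with argmin (f ∘ suc)
  ... | v , v-min with ≤-total (f zero) (f (suc v))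
  ...   | inj₁ f0≤fv = zero , λ { zero → ≤-refl ; (suc w) → ≤-trans f0≤fv (v-min w) }
  ...   | inj₂ fv≤f0 = suc v , λ { zero → fv≤f0 ; (suc w) → v-min w }

  -- The condition is d(v) ≥ 64 k² n^(1/k), raised to the power k. At the minimum degree δ it gives
  -- δ^(2k) ≥ c^(2k) n² with c = 64 k², and c^(2k) ≥ 8k pays for the factor 2 in `manyCycles` and
  -- for the 4k labellings of each cycle.
  n²≤tC2k : ∀ h n (G : Graph n) →
            (∀ v → (64 * suc h * suc h) ^ suc h * n ≤ degree G v ^ suc h) → n * n ≤ tC2k (suc h) G
  n²≤tC2k h zero       G large = z≤n
  n²≤tC2k h n@(suc _)  G large = begin
    n * n                          ≡⟨ m*n/n≡m (n * n) (4 * k) ⟨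
    n * n * (4 * k) / (4 * k)      ≤⟨ /-monoˡ-≤ (4 * k) (*-cancelˡ-≤ {n * n * (4 * k)} {labelledCycles k G} 2 enough) ⟩
    labelledCycles k G / (4 * k)   ∎
    where
    open ≤-Reasoning
    k = suc h
    c = 64 * k * k
    d = degree G
    -- As `c ^ k * n` is positive, the degree condition excludes isolated vertices.
    degree≢0 : ∀ v → NonZero (d v)
    degree≢0 v = ≢-nonZero λ d≡0 → ≢-nonZero⁻¹ (c ^ k * n) {{m*n≢0 (c ^ k) n {{m^n≢0 c k}}}}
      (n≤0⇒n≡0 (≤-trans (large v) (≤-reflexive (cong (_^ k) d≡0))))
    -- Every degree divides this product, so the division that defines `ω` is exact.
    L = product (map d (allFin n))
    ω : Fin n → ℕ
    ω v = _/_ L (d v) {{degree≢0 v}}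
    ω*d≡L : ∀ v → ω v * d v ≡ L
    ω*d≡L v = m/n*n≡m {{degree≢0 v}} (∈⇒∣product (∈-map⁺ d (∈-allFin v)))
    L≢0 : NonZero L
    L≢0 = product≢0 (All-map⁺ (universal degree≢0 (allFin n)))
    -- The bound `δ` is attained at a vertex, so that `large` applies to it.
    v₀ = proj₁ (argmin d)
    δ = d v₀
    S≢0 : NonZero (∑ (allFin n) d)
    S≢0 = >-nonZero (≤-trans (>-nonZero⁻¹ (d zero) {{degree≢0 zero}}) (m≤m+n (d zero) _))
    open WeightedWalks G ω L ω*d≡L degree≢0 using (manyCycles)
    many : δ ^ (k + k) ≤ 2 * labelledCycles k G
    -- In `labelledCycles` the length `2 * k` unfolds to `k + (k + 0)`.
    many = subst (λ N → δ ^ (k + k) ≤ 2 * count (λ xs → allDistinct xs ∧ closedWalk G xs) (allSeqs N n))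
      (cong (k +_) (sym (+-identityʳ k)))
      (manyCycles δ (proj₂ (argmin d)) {{S≢0}} {{degree≢0 v₀}} {{L≢0}} h (large v₀))
    identity₁ : ∀ n k → 2 * (n * n * (4 * k)) ≡ 8 * k * (n * n)
    identity₁ = solve-∀
    identity₂ : ∀ a n → a * a * (n * n) ≡ (a * n) * (a * n)
    identity₂ = solve-∀
    8k≤c²ᵏ : 8 * k ≤ c ^ k * c ^ k
    8k≤c²ᵏ = begin
      8 * k          ≤⟨ *-monoˡ-≤ k (m≤m+n 8 56) ⟩
      64 * k         ≤⟨ m≤m*n (64 * k) k ⟩
      c              ≤⟨ m≤m*n c (c ^ h) {{m^n≢0 c h}} ⟩
      c ^ k          ≤⟨ m≤m*n (c ^ k) (c ^ k) {{m^n≢0 c k}} ⟩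
      c ^ k * c ^ k  ∎
    enough : 2 * (n * n * (4 * k)) ≤ 2 * labelledCycles k G
    enough = begin
      2 * (n * n * (4 * k))        ≡⟨ identity₁ n k ⟩
      8 * k * (n * n)              ≤⟨ *-monoˡ-≤ (n * n) 8k≤c²ᵏ ⟩
      c ^ k * c ^ k * (n * n)      ≡⟨ identity₂ (c ^ k) n ⟩
      (c ^ k * n) * (c ^ k * n)    ≤⟨ *-mono-≤ (large v₀) (large v₀) ⟩
      δ ^ k * δ ^ k                ≡⟨ ^-distribˡ-+-* δ k k ⟨
      δ ^ (k + k)                  ≤⟨ many ⟩
      2 * labelledCycles k G       ∎

open Supersaturation

-- Passage to rational numbers.

open import Data.Integer using (+_)
import Data.Integer as ℤ
import Data.Integer.Properties as ℤ
open import Data.Rational using (ℚ; 0ℚ; 1ℚ; _*_; mkℚ; *≤*; NonNegative; nonNegative) renaming (_≤_ to _≤ℚ_; _<_ to _<ℚ_; _/_ to _÷ℚ_)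
import Data.Rational.Properties as ℚ

module RationalEmbedding where

  -- The same number as `toℚ m`, given directly in lowest terms so that order and multiplication
  -- compute for a variable `m`.
  natℚ : ℕ → ℚ
  natℚ m = mkℚ (+ m) 0 (Coprimality.sym (Coprimality.1-coprimeTo m))

  toℚ≡natℚ : ∀ m → toℚ m ≡ natℚ m
  toℚ≡natℚ m = ℚ.normalize-coprime (Coprimality.sym (Coprimality.1-coprimeTo m))

  toℚ-* : ∀ m n → toℚ (m Data.Nat.* n) ≡ toℚ m * toℚ n
  toℚ-* m n = trans (cong (_÷ℚ 1) (ℤ.pos-* m n)) (sym (cong₂ _*_ (toℚ≡natℚ m) (toℚ≡natℚ n)))

  toℚ-^ : ∀ m k → toℚ (m ^ k) ≡ toℚ m ^ℚ k
  toℚ-^ m zero    = refl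
  toℚ-^ m (suc k) = trans (toℚ-* m (m ^ k)) (cong (toℚ m *_) (toℚ-^ m k))

  toℚ-mono-≤ : ∀ {m n} → m ≤ n → toℚ m ≤ℚ toℚ n
  toℚ-mono-≤ {m} {n} m≤n = subst₂ _≤ℚ_ (sym (toℚ≡natℚ m)) (sym (toℚ≡natℚ n))
    (*≤* (ℤ.*-monoʳ-≤-nonNeg (+ 1) (ℤ.+≤+ m≤n)))

  toℚ-cancel-≤ : ∀ {m n} → toℚ m ≤ℚ toℚ n → m ≤ n
  toℚ-cancel-≤ {m} {n} le with subst₂ _≤ℚ_ (toℚ≡natℚ m) (toℚ≡natℚ n) le
  ... | *≤* m1≤n1 = ℤ.drop‿+≤+ (subst₂ ℤ._≤_ (ℤ.*-identityʳ (+ m)) (ℤ.*-identityʳ (+ n)) m1≤n1)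

  toℚ-nonNeg : ∀ m → NonNegative (toℚ m)
  toℚ-nonNeg m = ℚ.normalize-nonNeg m 1

  toℚ-^-mono-≤ : ∀ m {q} → toℚ m ≤ℚ q → NonNegative q → ∀ k → toℚ m ^ℚ k ≤ℚ q ^ℚ k
  toℚ-^-mono-≤ m m≤q q≥0 zero = ℚ.≤-refl
  toℚ-^-mono-≤ m {q} m≤q q≥0 (suc k) = ℚ.≤-trans
    (ℚ.*-monoʳ-≤-nonNeg (toℚ m ^ℚ k) {{subst NonNegative (toℚ-^ m k) (toℚ-nonNeg (m ^ k))}} m≤q)
    (ℚ.*-monoˡ-≤-nonNeg q {{q≥0}} (toℚ-^-mono-≤ m m≤q q≥0 k))

open RationalEmbedding

theorem4p5 : (k : ℕ) → 2 ≤ k → (D lam : ℚ) → 0ℚ <ℚ D → 0ℚ <ℚ lam →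
    toℚ (64 Data.Nat.* k Data.Nat.* k) ≤ℚ D → 1ℚ ≤ℚ lam →
    Σ ℚ (λ β → 0ℚ <ℚ β ×
    ((n : ℕ) (G : Graph n) →
    (toℚ 8 * lam) ^ℚ k ≤ℚ toℚ n →
    ((v : Fin n) →
    (D ^ℚ k * toℚ n ≤ℚ toℚ (degree G v) ^ℚ k) ×
    (toℚ (degree G v) ^ℚ k ≤ℚ (lam * D) ^ℚ k * toℚ n)) →
    β * toℚ n ^ℚ 2 ≤ℚ toℚ (tC2k k G)))
-- The witness is β = 1. Since `D` is at least the integer `c` = 64 k², the lower degree bound
-- becomes an inequality between natural numbers.
theorem4p5 k@(suc h) _ D lam 0<D _ c≤D _ = 1ℚ , ℚ.positive⁻¹ 1ℚ , λ n G _ degrees →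
  let
    large : ∀ v → c ^ k Data.Nat.* n ≤ degree G v ^ k
    large v = toℚ-cancel-≤ (begin
      toℚ (c ^ k Data.Nat.* n)   ≡⟨ toℚ-* (c ^ k) n ⟩
      toℚ (c ^ k) * toℚ n        ≡⟨ cong (_* toℚ n) (toℚ-^ c k) ⟩
      toℚ c ^ℚ k * toℚ n         ≤⟨ ℚ.*-monoʳ-≤-nonNeg (toℚ n) {{toℚ-nonNeg n}} (toℚ-^-mono-≤ c c≤D (nonNegative (ℚ.<⇒≤ 0<D)) k) ⟩
      D ^ℚ k * toℚ n             ≤⟨ proj₁ (degrees v) ⟩
      toℚ (degree G v) ^ℚ k      ≡⟨ toℚ-^ (degree G v) k ⟨
      toℚ (degree G v ^ k)       ∎)
  in begin
    1ℚ * toℚ n ^ℚ 2              ≡⟨ ℚ.*-identityˡ (toℚ n ^ℚ 2) ⟩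
    toℚ n ^ℚ 2                   ≡⟨ toℚ-^ n 2 ⟨
    toℚ (n ^ 2)                  ≤⟨ toℚ-mono-≤ (≤-trans (≤-reflexive (cong (n Data.Nat.*_) (*-identityʳ n))) (n²≤tC2k h n G large)) ⟩
    toℚ (tC2k k G)               ∎
  where
  open ℚ.≤-Reasoning
  c = 64 Data.Nat.* k Data.Nat.* k
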